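{- Let $m$ be a positive integer and let $(l_i)_{i\geq 1}$ be an infinite sequence of integers, each relatively prime to $m$. For every $n\in\mathbb{N}$ let $L(l_1,\ldots,l_n)$ be the source of the iterated join of maps $B\phi^{l_1}\ast\cdots\ast B\phi^{l_n}$ over $B\mathbb{Z}_m$ (with $L()=0$, the empty type), and let $L^\infty$ be the sequential colimit of $$0 = L() \to L(l_1)\to L(l_1,l_2)\to L(l_1,l_2,l_3)\to\cdots$$ along the canonical inclusions $L(l_1,\ldots,l_n)\to L(l_1,\ldots,l_n,l_{n+1})$ given by the left pushout injection of the join. Then $L^\infty$ is a delooping of $\mathbb{Z}_m$, i.e. it is equivalent to $B\mathbb{Z}_m$ (a pointed connected type whose loop space is the group $\mathbb{Z}_m$).
   Context: Work in homotopy type theory (univalent type theory with higher inductive types); all (co)limits are homotopy (co)limits. A delooping of a group $G$ is a pointed connected type $BG$ with an identification of groups $\Omega BG = G$; it exists and is unique, and any group morphism $f:G\to H$ induces a unique pointed map $Bf:BG\to BH$ with $\Omega Bf=f$ (modulo these identifications). The circle $\mathbb{S}^1$ is a delooping of $\mathbb{Z}$. For an integer $l$, $\phi^l:\mathbb{Z}\to\mathbb{Z}_m$ is the group morphism sending $1$ to $l$, and $B\phi^l:\mathbb{S}^1\to B\mathbb{Z}_m$ its delooping. Join of maps: for $f:A\to C$, $g:B\to C$, let $A\times_C B=\Sigma(a:A).\Sigma(b:B).(f(a)=g(b))$; $A\ast_C B$ is the pushout of the two projections $A\leftarrow A\times_C B\to B$ (with left injection $\mathrm{inl}:A\to A\ast_C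 B$), and $f\ast g:A\ast_C B\to C$ is the map induced by $f$ and $g$. Iterated joins are formed left to right: $B\phi^{l_1}\ast\cdots\ast B\phi^{l_{n+1}} = (B\phi^{l_1}\ast\cdots\ast B\phi^{l_n})\ast B\phi^{l_{n+1}}$, starting from the unique map $0\to B\mathbb{Z}_m$. -}

{-# OPTIONS --without-K #-}
module Defs where

open import Level using (0ℓ; Setω) renaming (suc to lsuc)
open import Algebra.Bundles using (Group)
open import Algebra.Morphism.Bundles using (GroupHomomorphism)
open import Algebra.Morphism.Structures using (module GroupMorphisms)
open import Algebra.Structures using (IsGroup)
import Algebra.Properties.Group as GroupProperties
open import Axiom.Extensionality.Propositional using (Extensionality)
open import Axiom.UniquenessOfIdentityProofs using (UIP; module Constant⇒UIP)
open import Data.Empty using (⊥; ⊥-elim)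
open import Data.Fin using (Fin; toℕ; fromℕ<)
open import Data.Fin.Properties using (toℕ-injective; toℕ-fromℕ<; toℕ<n)
open import Data.Integer using (ℤ; +_; -[1+_]; _+_; _*_; -_; _-_; _⊖_; ∣_∣; 0ℤ; _%ℕ_; _/ℕ_) renaming (suc to sucℤ; pred to predℤ)
open import Data.Integer.DivMod using (n%ℕd<d; a≡a%ℕn+[a/ℕn]*n)
import Data.Integer.Properties as ℤ
open import Data.Integer.Tactic.RingSolver using (solve-∀)
open import Data.Nat as ℕ using (ℕ; zero; suc; NonZero)
open import Data.Nat.Divisibility using (divides; >⇒∤)
import Data.Nat.DivMod as ℕ
import Data.Nat.Properties as ℕ
open import Data.Product using (Σ; Σ-syntax; _×_; _,_; proj₁; proj₂)
open import Function using (id; _∘_)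
open import Function.Bundles using (mk↔ₛ′)
open import Function.Properties.Inverse.HalfAdjointEquivalence using (_≃_; ↔⇒≃)
open import Relation.Binary.PropositionalEquality hiding ([_])
open import Relation.Nullary using (contradiction)

open ≡-Reasoning

isContr : ∀ {a} → Set a → Set a
isContr A = Σ[ x ∈ A ] (∀ y → x ≡ y)

subst-const : ∀ {a b} {A : Set a} {B : Set b} {x y : A} (p : x ≡ y) {z : B} → subst (λ _ → B) p z ≡ z
subst-const refl = refl

idToEquiv : ∀ {a} {A B : Set a} → A ≡ B → A ≃ B
idToEquiv refl = record
  { to = id ; from = id
  ; left-inverse-of = λ _ → refl ; right-inverse-of = λ _ → refl
  ; left-right = λ _ → refl }

-- The canonical map idToEquiv is itself an equivalence.
Univalence : ∀ a → Set (lsuc a)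
Univalence a = (A B : Set a) →
  Σ[ e ∈ (A ≡ B) ≃ (A ≃ B) ] (∀ p → _≃_.to e p ≡ idToEquiv p)

-- Higher inductive types, presented by their constructors, their induction
-- principle (into families at every level) and its computation rules, all of
-- which, including those for points, are identifications.

record PushoutOf {A B C : Set} (f : C → A) (g : C → B) : Setω where
  field
    Carrier  : Set
    inl      : A → Carrier
    inr      : B → Carrier
    glue     : ∀ c → inl (f c) ≡ inr (g c)

    ind      : ∀ {ℓ} (P : Carrier → Set ℓ)
               (l : ∀ a → P (inl a)) (r : ∀ b → P (inr b))
               (h : ∀ c → subst P (glue c) (l (f c)) ≡ r (g c)) → ∀ x → P x
    ind-inl  : ∀ {ℓ} (P : Carrier → Set ℓ) l r h a → ind P l r h (inl a) ≡ l a
    ind-inr  : ∀ {ℓ} (P : Carrier → Set ℓ) l r h b → ind P l r h (inr b) ≡ r b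
    ind-glue : ∀ {ℓ} (P : Carrier → Set ℓ) l r h c →
               trans (dcong (ind P l r h) (glue c)) (ind-inr P l r h (g c))
               ≡ trans (cong (subst P (glue c)) (ind-inl P l r h (f c))) (h c)

record SeqColimOf (X : ℕ → Set) (f : ∀ n → X n → X (suc n)) : Setω where
  field
    Carrier  : Set
    incl     : ∀ n → X n → Carrier
    push     : ∀ n x → incl n x ≡ incl (suc n) (f n x)

    ind      : ∀ {ℓ} (P : Carrier → Set ℓ) (i : ∀ n x → P (incl n x))
               (h : ∀ n x → subst P (push n x) (i n x) ≡ i (suc n) (f n x)) → ∀ x → P x
    ind-incl : ∀ {ℓ} (P : Carrier → Set ℓ) i h n x → ind P i h (incl n x) ≡ i n x
    ind-push : ∀ {ℓ} (P : Carrier → Set ℓ) i h n x →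
               trans (dcong (ind P i h) (push n x)) (ind-incl P i h (suc n) (f n x))
               ≡ trans (cong (subst P (push n x)) (ind-incl P i h n x)) (h n x)

record CircleType : Setω where
  field
    S¹       : Set
    base     : S¹
    loop     : base ≡ base

    ind      : ∀ {ℓ} (P : S¹ → Set ℓ) (b : P base) (h : subst P loop b ≡ b) → ∀ x → P x
    ind-base : ∀ {ℓ} (P : S¹ → Set ℓ) b h → ind P b h base ≡ b
    ind-loop : ∀ {ℓ} (P : S¹ → Set ℓ) b h →
               trans (dcong (ind P b h) loop) (ind-base P b h)
               ≡ trans (cong (subst P loop) (ind-base P b h)) h

record SetTruncationOf (A : Set) : Setω where
  field
    Carrier : Set
    ∣_∣₀    : A → Carrier
    isSet   : UIP Carrier

    ind     : ∀ {ℓ} (P : Carrier → Set ℓ) → (∀ x → UIP (P x)) →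
              (∀ a → P ∣ a ∣₀) → ∀ x → P x
    ind-∣∣₀ : ∀ {ℓ} (P : Carrier → Set ℓ) s p a → ind P s p ∣ a ∣₀ ≡ p a

-- The ambient theory: intensional type theory without K, in which the axioms
-- of homotopy type theory are an explicit hypothesis, with Set as the universe
-- of types.  Function extensionality follows from univalence and is listed
-- only for convenience.
record HoTT : Setω where
  field
    funext        : ∀ {a b} → Extensionality a b
    univalence    : ∀ a → Univalence a
    pushout       : ∀ {A B C : Set} (f : C → A) (g : C → B) → PushoutOf f g
    seqColim      : ∀ (X : ℕ → Set) (f : ∀ n → X n → X (suc n)) → SeqColimOf X f
    circle        : CircleType
    setTruncation : ∀ (A : Set) → SetTruncationOf A

  open CircleType circle public using (S¹)

Ω-group : ∀ {A : Set} (a : A) → Group 0ℓ 0ℓ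
Ω-group a = record
  { Carrier = a ≡ a ; _≈_ = _≡_ ; _∙_ = trans ; ε = refl ; _⁻¹ = sym
  ; isGroup = record
    { isMonoid = record
      { isSemigroup = record
        { isMagma = record { isEquivalence = isEquivalence ; ∙-cong = cong₂ trans }
        ; assoc = λ p q r → trans-assoc p }
      ; identity = (λ _ → refl) , trans-reflʳ }
    ; inverse = trans-symˡ , trans-symʳ
    ; ⁻¹-cong = cong sym } }

ℤ-group : Group 0ℓ 0ℓ
ℤ-group = record { isGroup = ℤ.+-0-isGroup }

module Cyclic (m : ℕ) .{{_ : NonZero m}} where

  infixl 6 _⊕_
  infix 8 ⊝_

  [_] : ℤ → Fin m
  [ k ] = fromℕ< (n%ℕd<d k m)

  _⊕_ : Fin m → Fin m → Fin m
  i ⊕ j = [ + toℕ i + + toℕ j ]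

  ⊝_ : Fin m → Fin m
  ⊝ i = [ - + toℕ i ]

  private
    -- |r - s| < m and m ∣ r - s force r = s.
    small : ∀ r s q → r ℕ.< m → s ℕ.< m → + r ≡ + s + q * + m → r ≡ s
    small r s q r<m s<m eq = ℤ.+-injective (ℤ.i-j≡0⇒i≡j (+ r) (+ s) (ℤ.∣i∣≡0⇒i≡0 abs≡0))
      where
      diff : + r - + s ≡ q * + m
      diff = begin
        + r - + s               ≡⟨ cong (_- + s) eq ⟩
        + s + q * + m - + s     ≡⟨ cancel (+ s) (q * + m) ⟩
        q * + m                 ∎
        where
        cancel : ∀ a b → a + b - a ≡ b
        cancel = solve-∀
      abs<m : ∣ + r - + s ∣ ℕ.< m
      abs<m = subst (λ z → ∣ z ∣ ℕ.< m) (sym (ℤ.m-n≡m⊖n r s))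
        (ℕ.≤-<-trans (ℤ.∣m⊝n∣≤m⊔n r s) (ℕ.⊔-lub r<m s<m))
      abs≡ : ∣ + r - + s ∣ ≡ ∣ q ∣ ℕ.* m
      abs≡ = trans (cong ∣_∣ diff) (ℤ.abs-* q (+ m))
      abs≡0 : ∣ + r - + s ∣ ≡ 0
      abs≡0 with ∣ + r - + s ∣ in e
      ... | zero  = refl
      ... | suc d = contradiction
        (divides ∣ q ∣ (trans (sym e) abs≡)) (>⇒∤ (subst (ℕ._< m) e abs<m))

  []-section : ∀ i → [ + toℕ i ] ≡ i
  []-section i = toℕ-injective (trans (toℕ-fromℕ< _) (ℕ.m<n⇒m%n≡m (toℕ<n i)))

  []-cong : ∀ {x y} q → x ≡ y + q * + m → [ x ] ≡ [ y ]
  []-cong {x} {y} q eq = toℕ-injective (begin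
    toℕ [ x ]   ≡⟨ toℕ-fromℕ< _ ⟩
    x %ℕ m      ≡⟨ small _ _ (y /ℕ m + q - x /ℕ m) (n%ℕd<d x m) (n%ℕd<d y m) rem ⟩
    y %ℕ m      ≡⟨ toℕ-fromℕ< _ ⟨
    toℕ [ y ]   ∎)
    where
    ring₁ : ∀ r a m → r ≡ (r + a * m) - a * m
    ring₁ = solve-∀
    ring₂ : ∀ s b q a m → (s + b * m) + q * m - a * m ≡ s + (b + q - a) * m
    ring₂ = solve-∀
    rem : + (x %ℕ m) ≡ + (y %ℕ m) + (y /ℕ m + q - x /ℕ m) * + m
    rem = begin
      + (x %ℕ m)                                          ≡⟨ ring₁ (+ (x %ℕ m)) (x /ℕ m) (+ m) ⟩
      (+ (x %ℕ m) + x /ℕ m * + m) - x /ℕ m * + m          ≡⟨ cong (_- x /ℕ m * + m) (a≡a%ℕn+[a/ℕn]*n x m) ⟨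
      x - x /ℕ m * + m                                    ≡⟨ cong (_- x /ℕ m * + m) eq ⟩
      y + q * + m - x /ℕ m * + m                          ≡⟨ cong (λ z → z + q * + m - x /ℕ m * + m) (a≡a%ℕn+[a/ℕn]*n y m) ⟩
      + (y %ℕ m) + y /ℕ m * + m + q * + m - x /ℕ m * + m  ≡⟨ ring₂ (+ (y %ℕ m)) (y /ℕ m) q (x /ℕ m) (+ m) ⟩
      + (y %ℕ m) + (y /ℕ m + q - x /ℕ m) * + m            ∎

  private
    rep : ∀ x → x ≡ + toℕ [ x ] + x /ℕ m * + m
    rep x = trans (a≡a%ℕn+[a/ℕn]*n x m)
                  (cong (λ r → + r + x /ℕ m * + m) (sym (toℕ-fromℕ< (n%ℕd<d x m))))

  []-+ : ∀ x y → [ x + y ] ≡ [ x ] ⊕ [ y ]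
  []-+ x y = []-cong {x + y} {+ toℕ [ x ] + + toℕ [ y ]} (x /ℕ m + y /ℕ m) (trans (cong₂ _+_ (rep x) (rep y)) (ring (+ toℕ [ x ]) (x /ℕ m) (+ toℕ [ y ]) (y /ℕ m) (+ m)))
    where
    ring : ∀ r a s b m → r + a * m + (s + b * m) ≡ r + s + (a + b) * m
    ring = solve-∀

  []-neg : ∀ x → [ - x ] ≡ ⊝ [ x ]
  []-neg x = []-cong { - x } { - + toℕ [ x ]} (- (x /ℕ m)) (trans (cong -_ (rep x)) (ring (+ toℕ [ x ]) (x /ℕ m) (+ m)))
    where
    ring : ∀ r a m → - (r + a * m) ≡ - r + - a * m
    ring = solve-∀

  private
    assoc : ∀ i j k → (i ⊕ j) ⊕ k ≡ i ⊕ (j ⊕ k)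
    assoc i j k = begin
      (i ⊕ j) ⊕ k          ≡⟨ cong ((i ⊕ j) ⊕_) ([]-section k) ⟨
      [ a + b ] ⊕ [ c ]    ≡⟨ []-+ (a + b) c ⟨
      [ a + b + c ]        ≡⟨ cong [_] (ℤ.+-assoc a b c) ⟩
      [ a + (b + c) ]      ≡⟨ []-+ a (b + c) ⟩
      [ a ] ⊕ (j ⊕ k)      ≡⟨ cong (_⊕ (j ⊕ k)) ([]-section i) ⟩
      i ⊕ (j ⊕ k)          ∎
      where
      a = + toℕ i
      b = + toℕ j
      c = + toℕ k

    comm : ∀ i j → i ⊕ j ≡ j ⊕ i
    comm i j = cong [_] (ℤ.+-comm (+ toℕ i) (+ toℕ j))

    identityˡ : ∀ i → [ 0ℤ ] ⊕ i ≡ i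
    identityˡ i = begin
      [ 0ℤ ] ⊕ i                ≡⟨ cong ([ 0ℤ ] ⊕_) ([]-section i) ⟨
      [ 0ℤ ] ⊕ [ + toℕ i ]      ≡⟨ []-+ 0ℤ (+ toℕ i) ⟨
      [ + toℕ i ]               ≡⟨ []-section i ⟩
      i                         ∎

    inverseˡ : ∀ i → ⊝ i ⊕ i ≡ [ 0ℤ ]
    inverseˡ i = begin
      ⊝ i ⊕ i                   ≡⟨ cong (⊝ i ⊕_) ([]-section i) ⟨
      ⊝ i ⊕ [ + toℕ i ]         ≡⟨ []-+ (- + toℕ i) (+ toℕ i) ⟨
      [ - + toℕ i + + toℕ i ]   ≡⟨ cong [_] (ℤ.+-inverseˡ (+ toℕ i)) ⟩
      [ 0ℤ ]                    ∎

  ℤ/m-group : Group 0ℓ 0ℓ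
  ℤ/m-group = record
    { Carrier = Fin m ; _≈_ = _≡_ ; _∙_ = _⊕_ ; ε = [ 0ℤ ] ; _⁻¹ = ⊝_
    ; isGroup = record
      { isMonoid = record
        { isSemigroup = record
          { isMagma = record { isEquivalence = isEquivalence ; ∙-cong = cong₂ _⊕_ }
          ; assoc = assoc }
        ; identity = identityˡ , λ i → trans (comm i _) (identityˡ i) }
      ; inverse = inverseˡ , λ i → trans (comm i _) (inverseˡ i)
      ; ⁻¹-cong = cong ⊝_ } }

open Cyclic public using (ℤ/m-group)

φ : ∀ m .{{_ : NonZero m}} → ℤ → GroupHomomorphism (Group.rawGroup ℤ-group) (Group.rawGroup (ℤ/m-group m))
φ m l = record
  { ⟦_⟧ = λ k → [ k * l ]
  ; isGroupHomomorphism = record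
    { isMonoidHomomorphism = record
      { isMagmaHomomorphism = record
        { isRelHomomorphism = record { cong = cong (λ k → [ k * l ]) }
        ; homo = λ j k → trans (cong [_] (ℤ.*-distribʳ-+ l j k)) ([]-+ (j * l) (k * l)) }
      ; ε-homo = cong [_] (ℤ.*-zeroˡ l) }
    ; ⁻¹-homo = λ k → trans (cong [_] (sym (ℤ.neg-distribˡ-* k l))) ([]-neg (k * l)) } }
  where open Cyclic m

φ-1 : ∀ m .{{_ : NonZero m}} l → GroupHomomorphism.⟦_⟧ (φ m l) (+ 1) ≡ Cyclic.[_] m l
φ-1 m l = cong (Cyclic.[_] m) (ℤ.*-identityˡ l)

module _ (H : HoTT) where
  open HoTT H

  isConnected : Set → Set
  isConnected A = isContr (SetTruncationOf.Carrier (setTruncation A))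

  -- B, with a point, is connected and its loop space is identified with G.
  -- The groups used here have a set with identity as equality as carrier, for
  -- which a group isomorphism is a homomorphism that is an equivalence.
  record IsDelooping (G : Group 0ℓ 0ℓ) (B : Set) : Set where
    field
      pt        : B
      connected : isConnected B

    open GroupMorphisms (Group.rawGroup (Ω-group pt)) (Group.rawGroup G)

    field
      iso   : pt ≡ pt → Group.Carrier G
      isIso : IsGroupIsomorphism iso

  -- A pointed map between deloopings inducing the given morphism on loop spaces.
  record DeloopingMap {G K : Group 0ℓ 0ℓ} {BG BK : Set}
                      (dG : IsDelooping G BG) (dK : IsDelooping K BK)
                      (f : GroupHomomorphism (Group.rawGroup G) (Group.rawGroup K)) : Set where
    module G = IsDelooping dG
    module K = IsDelooping dK
    field
      fun     : BG → BK
      pointed : fun G.pt ≡ K.pt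

    Ω-fun : G.pt ≡ G.pt → K.pt ≡ K.pt
    Ω-fun p = trans (sym pointed) (trans (cong fun p) pointed)

    field
      Ω-fun-≈ : ∀ p → Group._≈_ K (K.iso (Ω-fun p)) (GroupHomomorphism.⟦_⟧ f (G.iso p))

  module _ {A B C : Set} (f : A → C) (g : B → C) where

    Pullback : Set
    Pullback = Σ[ a ∈ A ] Σ[ b ∈ B ] f a ≡ g b

    private module J = PushoutOf (pushout {C = Pullback} proj₁ (proj₁ ∘ proj₂))

    Join : Set
    Join = J.Carrier

    join-inl : A → Join
    join-inl = J.inl

    join-map : Join → C
    join-map = J.ind (λ _ → C) f g λ (a , b , p) → trans (subst-const (J.glue (a , b , p))) p

  module _ {A C : Set} (g : ℕ → A → C) where

    -- The iterated join g 0 ∗ … ∗ g (n - 1), as a source and a map to C.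
    iterated-join : ℕ → Σ[ X ∈ Set ] (X → C)
    iterated-join zero    = ⊥ , ⊥-elim
    iterated-join (suc n) =
      Join (proj₂ (iterated-join n)) (g n) , join-map (proj₂ (iterated-join n)) (g n)

    L : ℕ → Set
    L n = proj₁ (iterated-join n)

    L-incl : ∀ n → L n → L (suc n)
    L-incl n = join-inl (proj₂ (iterated-join n)) (g n)

    L∞ : Set
    L∞ = SeqColimOf.Carrier (seqColim L L-incl)

-- The circle is a delooping of ℤ, with loop corresponding to 1: the universal
-- cover, with fibre ℤ and monodromy the successor, has paths from base as fibres.
module Circle (H : HoTT) where
  open HoTT H
  open CircleType circle renaming (ind to S¹-ind; ind-base to S¹-ind-base; ind-loop to S¹-ind-loop) hiding (S¹)
  private module T = SetTruncationOf (setTruncation S¹)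

  private
    coe : ∀ {A B : Set} → A ≡ B → A → B
    coe p = subst id p

    ua : ∀ {A B : Set} → A ≃ B → A ≡ B
    ua {A} {B} = _≃_.from (proj₁ (univalence _ A B))

    coe-ua : ∀ {A B : Set} (e : A ≃ B) x → coe (ua e) x ≡ _≃_.to e x
    coe-ua {A} {B} e x = trans (lemma (ua e)) (cong (λ e′ → _≃_.to e′ x)
        (trans (sym (proj₂ u (ua e))) (_≃_.right-inverse-of (proj₁ u) e)))
      where
      u = univalence _ A B
      lemma : ∀ {B} (p : A ≡ B) → coe p x ≡ _≃_.to (idToEquiv p) x
      lemma refl = refl

    suc≃ : ℤ ≃ ℤ
    suc≃ = ↔⇒≃ (mk↔ₛ′ sucℤ predℤ ℤ.suc-pred ℤ.pred-suc)

    cover-loop : subst (λ _ → Set) loop ℤ ≡ ℤ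
    cover-loop = trans (subst-const loop) (ua suc≃)

    C : S¹ → Set
    C = S¹-ind (λ _ → Set) ℤ cover-loop

    c : C base ≡ ℤ
    c = S¹-ind-base (λ _ → Set) ℤ cover-loop

    C-suc : ∀ y → coe c (subst C loop y) ≡ sucℤ (coe c y)
    C-suc y = begin
      coe c (subst C loop y)      ≡⟨ monodromy C loop c (S¹-ind-loop _ ℤ cover-loop) y ⟩
      coe (ua suc≃) (coe c y)     ≡⟨ coe-ua suc≃ (coe c y) ⟩
      sucℤ (coe c y)              ∎
      where
      split : ∀ {A B D : Set} (p : A ≡ B) (q : B ≡ D) x → coe (trans p q) x ≡ coe q (coe p x)
      split refl q x = refl
      along : ∀ {a b} (D : S¹ → Set) (p : a ≡ b) {Z W : Set} (d : D a ≡ Z) (e : D b ≡ W) (v : Z ≡ W) →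
              trans (dcong D p) e ≡ trans (cong (subst (λ _ → Set) p) d) (trans (subst-const p) v) →
              ∀ y → coe e (subst D p y) ≡ coe v (coe d y)
      along D refl d e v h y = begin
        coe e y                          ≡⟨ cong (λ q → coe q y) h ⟩
        coe (trans (cong id d) v) y      ≡⟨ cong (λ q → coe (trans q v) y) (cong-id d) ⟩
        coe (trans d v) y                ≡⟨ split d v y ⟩
        coe v (coe d y)                  ∎
      monodromy : ∀ {a} (D : S¹ → Set) (p : a ≡ a) {Z : Set} (d : D a ≡ Z) {v : Z ≡ Z} →
              trans (dcong D p) d ≡ trans (cong (subst (λ _ → Set) p) d) (trans (subst-const p) v) →
              ∀ y → coe d (subst D p y) ≡ coe v (coe d y)
      monodromy D p d {v} = along D p d d v

    z₀ : C base
    z₀ = subst id (sym c) 0ℤ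

    encode : ∀ {x} → base ≡ x → C x
    encode p = subst C p z₀

    wind : base ≡ base → ℤ
    wind p = coe c (encode p)

    wind-refl : wind refl ≡ 0ℤ
    wind-refl = subst-subst-sym c

    wind-loop : ∀ p → wind (trans p loop) ≡ sucℤ (wind p)
    wind-loop p = trans (cong (coe c) (sym (subst-subst p))) (C-suc (encode p))

    wind-loop⁻ : ∀ p → wind (trans p (sym loop)) ≡ predℤ (wind p)
    wind-loop⁻ p = begin
      wind q                          ≡⟨ ℤ.pred-suc (wind q) ⟨
      predℤ (sucℤ (wind q))           ≡⟨ cong predℤ (wind-loop q) ⟨
      predℤ (wind (trans q loop))     ≡⟨ cong (predℤ ∘ wind) cancel ⟩
      predℤ (wind p)                  ∎
      where
      q = trans p (sym loop)
      cancel : trans q loop ≡ p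
      cancel = trans (trans-assoc p) (trans (cong (trans p) (trans-symˡ loop)) (trans-reflʳ p))

    power : ℤ → base ≡ base
    power (+ zero)     = refl
    power (+ suc n)    = trans (power (+ n)) loop
    power -[1+ zero ]  = sym loop
    power -[1+ suc n ] = trans (power -[1+ n ]) (sym loop)

    power-suc : ∀ k → power (sucℤ k) ≡ trans (power k) loop
    power-suc (+ n)        = refl
    power-suc -[1+ zero ]  = sym (trans-symˡ loop)
    power-suc -[1+ suc n ] = sym (begin
      trans (trans (power -[1+ n ]) (sym loop)) loop  ≡⟨ trans-assoc (power -[1+ n ]) ⟩
      trans (power -[1+ n ]) (trans (sym loop) loop)  ≡⟨ cong (trans _) (trans-symˡ loop) ⟩
      trans (power -[1+ n ]) refl                     ≡⟨ trans-reflʳ _ ⟩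
      power -[1+ n ]                                  ∎)

    wind-power : ∀ p k → wind (trans p (power k)) ≡ wind p + k
    wind-power p (+ zero) = trans (cong wind (trans-reflʳ p)) (sym (ℤ.+-identityʳ _))
    wind-power p (+ suc n) = begin
      wind (trans p (trans (power (+ n)) loop))    ≡⟨ cong wind (trans-assoc p) ⟨
      wind (trans (trans p (power (+ n))) loop)    ≡⟨ wind-loop (trans p (power (+ n))) ⟩
      sucℤ (wind (trans p (power (+ n))))          ≡⟨ cong sucℤ (wind-power p (+ n)) ⟩
      sucℤ (wind p + + n)                          ≡⟨ ring (wind p) (+ n) ⟩
      wind p + + suc n                             ∎
      where
      ring : ∀ a b → + 1 + (a + b) ≡ a + (+ 1 + b)
      ring = solve-∀
    wind-power p -[1+ zero ] = trans (wind-loop⁻ p) (ℤ.+-comm (-[1+ zero ]) (wind p))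
    wind-power p -[1+ suc n ] = begin
      wind (trans p (trans (power -[1+ n ]) (sym loop)))  ≡⟨ cong wind (trans-assoc p) ⟨
      wind (trans (trans p (power -[1+ n ])) (sym loop))  ≡⟨ wind-loop⁻ (trans p (power -[1+ n ])) ⟩
      predℤ (wind (trans p (power -[1+ n ])))             ≡⟨ cong predℤ (wind-power p -[1+ n ]) ⟩
      predℤ (wind p + -[1+ n ])                           ≡⟨ ring (wind p) -[1+ n ] ⟩
      wind p + -[1+ suc n ]                               ∎
      where
      ring : ∀ a b → - + 1 + (a + b) ≡ a + (- + 1 + b)
      ring = solve-∀

    wind∘power : ∀ k → wind (power k) ≡ k
    wind∘power k = trans (wind-power refl k) (trans (cong (_+ k) wind-refl) (ℤ.+-identityˡ k))

    P : S¹ → Set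
    P x = C x → base ≡ x

    decode-loop : subst P loop (power ∘ coe c) ≡ power ∘ coe c
    decode-loop = funext λ y → begin
      subst P loop (power ∘ coe c) y                            ≡⟨ transport loop (power ∘ coe c) y ⟩
      trans (power (coe c (subst C (sym loop) y))) loop         ≡⟨ power-suc (coe c (subst C (sym loop) y)) ⟨
      power (sucℤ (coe c (subst C (sym loop) y)))               ≡⟨ cong power (C-suc _) ⟨
      power (coe c (subst C loop (subst C (sym loop) y)))       ≡⟨ cong (power ∘ coe c) (subst-subst-sym loop) ⟩
      power (coe c y)                                           ∎
      where
      transport : ∀ {x} (p : base ≡ x) (f : P base) (y : C x) →
                  subst P p f y ≡ trans (f (subst C (sym p) y)) p
      transport refl f y = sym (trans-reflʳ (f y))

    decode : ∀ x → P x
    decode = S¹-ind P (power ∘ coe c) decode-loop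

    decode-encode : ∀ {x} (p : base ≡ x) → decode x (encode p) ≡ p
    decode-encode refl = trans
      (cong-app (S¹-ind-base P (power ∘ coe c) decode-loop) z₀)
      (cong power wind-refl)

    wind-injective : ∀ {p q} → wind p ≡ wind q → p ≡ q
    wind-injective {p} {q} eq = begin
      p                        ≡⟨ decode-encode p ⟨
      decode base (encode p)   ≡⟨ cong (decode base) (subst-injective c eq) ⟩
      decode base (encode q)   ≡⟨ decode-encode q ⟩
      q                        ∎

    wind-+ : ∀ p q → wind (trans p q) ≡ wind p + wind q
    wind-+ p q = trans
      (cong (wind ∘ trans p) (wind-injective (sym (wind∘power (wind q)))))
      (wind-power p (wind q))

    wind-sym : ∀ p → wind (sym p) ≡ - wind p
    wind-sym p = GroupProperties.inverseˡ-unique ℤ-group _ _ (begin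
      wind (sym p) + wind p    ≡⟨ wind-+ (sym p) p ⟨
      wind (trans (sym p) p)   ≡⟨ cong wind (trans-symˡ p) ⟩
      wind refl                ≡⟨ wind-refl ⟩
      0ℤ                       ∎)

    prop⇒set : ∀ {A : Set} → (∀ (x y : A) → x ≡ y) → UIP A
    prop⇒set h = Constant⇒UIP.≡-irrelevant (λ {x} {y} _ → h x y) (λ _ _ → refl)

  S¹-delooping : IsDelooping H ℤ-group S¹
  S¹-delooping = record
    { pt = base
    ; connected = T.∣ base ∣₀ , T.ind _ (λ _ → prop⇒set T.isSet)
        (S¹-ind _ refl (T.isSet _ _))
    ; iso = wind
    ; isIso = record
      { isGroupMonomorphism = record
        { isGroupHomomorphism = record
          { isMonoidHomomorphism = record
            { isMagmaHomomorphism = record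
              { isRelHomomorphism = record { cong = cong wind } ; homo = wind-+ }
            ; ε-homo = wind-refl }
          ; ⁻¹-homo = wind-sym }
        ; injective = wind-injective }
      ; surjective = λ k → power k , λ { refl → wind∘power k } } }

  S¹-delooping-loop : IsDelooping.iso S¹-delooping loop ≡ + 1
  S¹-delooping-loop = wind∘power (+ 1)

open Circle public using (S¹-delooping)

{-# OPTIONS --safe #-}
{-# OPTIONS --without-K #-}
module Submission where

open import Axiom.UniquenessOfIdentityProofs using (UIP; module Constant⇒UIP)
open import Data.Integer using (ℤ; +_)
open import Data.Integer.Coprimality using (Coprime)
open import Data.Nat using (ℕ; zero; suc; NonZero)
open import Data.Product using (Σ; Σ-syntax; _×_; _,_; proj₁; proj₂)
open import Data.Product.Properties using (Σ-≡,≡→≡)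
open import Function using (_∘_)
open import Function.Bundles using (mk↔ₛ′)
open import Function.Properties.Inverse.HalfAdjointEquivalence using (_≃_; ↔⇒≃)
open import Relation.Binary.PropositionalEquality hiding ([_])
open import Relation.Nullary.Irrelevant using (Irrelevant)
open import Defs

-- Only surjectivity of the maps S¹ → Bℤ/m matters.  A point b of S¹ over c
-- contracts the image of the fibre of L n over c in the fibre of L (suc n),
-- by gluing each of its points to inr b.  A sequential colimit along constant
-- maps is contractible, so L∞ → Bℤ/m has a contractible fibre over the base
-- point, and hence over every point, as Bℤ/m is connected.  The delooping
-- structure is then carried back to L∞ by univalence.

isContr⇒Irrelevant : ∀ {a} {A : Set a} → isContr A → Irrelevant A
isContr⇒Irrelevant (_ , h) x y = trans (sym (h x)) (h y)

Irrelevant⇒UIP : ∀ {a} {A : Set a} → Irrelevant A → UIP A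
Irrelevant⇒UIP h = Constant⇒UIP.≡-irrelevant (λ {x} {y} _ → h x y) (λ _ _ → refl)

Fibre : ∀ {A B : Set} → (A → B) → B → Set
Fibre {A} f b = Σ[ a ∈ A ] f a ≡ b

contractible-fibres⇒≃ : ∀ {A B : Set} (f : A → B) → (∀ b → isContr (Fibre f b)) → A ≃ B
contractible-fibres⇒≃ f contr = ↔⇒≃ (mk↔ₛ′ f
  (λ b → proj₁ (proj₁ (contr b)))
  (λ b → proj₂ (proj₁ (contr b)))
  (λ a → cong proj₁ (proj₂ (contr (f a)) (a , refl))))

-- The long hypothesis has the shape of the rule `ind-glue` for a non-dependent map. The endpoints
-- are kept free so that `p`, `d` and `v` yield to path induction.
subst-fibre : ∀ {A B : Set} (f : A → B) {x y : A} (p : x ≡ y)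
              {s t c : B} (d : f x ≡ s) (e : f y ≡ t) (v : s ≡ t) (q : t ≡ c) →
              trans (dcong f p) e ≡ trans (cong (subst (λ _ → B) p) d) (trans (subst-const p) v) →
              (w : f x ≡ c) → w ≡ trans d (trans v q) →
              subst (λ z → f z ≡ c) p w ≡ trans e q
subst-fibre f refl refl e refl q h w eq = trans eq (cong (λ r → trans r q) (sym h))

module _ (H : HoTT) where
  open HoTT H

  Irrelevant-isContr : ∀ {a} {A : Set a} → Irrelevant (isContr A)
  Irrelevant-isContr c@(_ , h) (y , k) =
    Σ-≡,≡→≡ (h y , funext λ _ → Irrelevant⇒UIP (isContr⇒Irrelevant c) _ _)

  Irrelevant-Irrelevant : ∀ {a} {A : Set a} → Irrelevant (Irrelevant A)
  Irrelevant-Irrelevant h k = funext λ x → funext λ y → Irrelevant⇒UIP h (h x y) (k x y)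

  hProp : Set₁
  hProp = Σ Set Irrelevant

  ua : ∀ {A B : Set} → A ≃ B → A ≡ B
  ua {A} {B} = _≃_.from (proj₁ (univalence _ A B))

  hProp-ext : ∀ {P Q : hProp} → (proj₁ P → proj₁ Q) × (proj₁ Q → proj₁ P) → P ≡ Q
  hProp-ext {_ , hP} {_ , hQ} (f , g) = Σ-≡,≡→≡
    (ua (↔⇒≃ (mk↔ₛ′ f g (λ _ → hQ _ _) (λ _ → hP _ _))) , Irrelevant-Irrelevant _ _)

  -- Every identification factors through the proposition of logical equivalence.
  UIP-hProp : UIP hProp
  UIP-hProp = Constant⇒UIP.≡-irrelevant (λ p → hProp-ext (to-iff p))
    (λ {P} {Q} p q → cong hProp-ext (irrelevant-iff {P} {Q} (to-iff p) (to-iff q)))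
    where
    Iff : hProp → hProp → Set
    Iff P Q = (proj₁ P → proj₁ Q) × (proj₁ Q → proj₁ P)
    to-iff : ∀ {P Q} → P ≡ Q → Iff P Q
    to-iff p = subst proj₁ p , subst proj₁ (sym p)
    irrelevant-iff : ∀ {P Q} → Irrelevant (Iff P Q)
    irrelevant-iff {_ , hP} {_ , hQ} _ _ =
      cong₂ _,_ (funext λ _ → hQ _ _) (funext λ _ → hP _ _)

  -- Connectedness is contractibility of the set truncation. Since `hProp` is a set, `P` factors
  -- through the truncation and is therefore constant.
  connected-ind : ∀ {A : Set} → isConnected H A → (P : A → Set) → (∀ x → Irrelevant (P x)) →
                  ∀ {a} → P a → ∀ x → P x
  connected-ind {A} conn P hP {a} pa x =
    subst proj₁ (trans (sym (∥P∥-β a)) (trans (cong ∥P∥ ∣a∣≡∣x∣) (∥P∥-β x))) pa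
    where
    open SetTruncationOf (setTruncation A)
    ∥P∥ : Carrier → hProp
    ∥P∥ = ind (λ _ → hProp) (λ _ → UIP-hProp) (λ y → P y , hP y)
    ∥P∥-β : ∀ y → ∥P∥ ∣ y ∣₀ ≡ (P y , hP y)
    ∥P∥-β = ind-∣∣₀ (λ _ → hProp) (λ _ → UIP-hProp) (λ y → P y , hP y)
    ∣a∣≡∣x∣ : ∣ a ∣₀ ≡ ∣ x ∣₀
    ∣a∣≡∣x∣ = isContr⇒Irrelevant conn _ _

  -- The total space of a family over a sequential colimit is the sequential
  -- colimit of the total spaces at each stage; here its maps are constant.
  module _ {X : ℕ → Set} {f : ∀ n → X n → X (suc n)}
           (E : SeqColimOf.Carrier (seqColim X f) → Set) where
    private open module Q = SeqColimOf (seqColim X f)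

    StageTotal : ℕ → Set
    StageTotal n = Σ[ x ∈ X n ] E (incl n x)

    stage-map : ∀ n → StageTotal n → StageTotal (suc n)
    stage-map n (x , e) = f n x , subst E (push n x) e

    Σ-seqColim-isContr : (z : ∀ n → StageTotal (suc n)) →
                         (∀ n u → stage-map n u ≡ z n) → isContr (Σ Q.Carrier E)
    -- Stage 0 may be empty, so the centre is taken in stage 1, the first with a chosen point.
    Σ-seqColim-isContr z σ≡z = ι 1 (z 0) , λ (x , e) → contract x e
      where
      ι : ∀ n → StageTotal n → Σ Q.Carrier E
      ι n (x , e) = incl n x , e

      π : ∀ n u → ι n u ≡ ι (suc n) (stage-map n u)
      π n (x , e) = Σ-≡,≡→≡ (push n x , refl)

      to-z : ∀ n u → ι n u ≡ ι (suc n) (z n)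
      to-z n u = trans (π n u) (cong (ι (suc n)) (σ≡z n u))

      centre-z : ∀ n → ι 1 (z 0) ≡ ι (suc n) (z n)
      centre-z zero    = refl
      centre-z (suc n) = trans (centre-z n) (to-z (suc n) (z n))

      contract-stage : ∀ n u → ι 1 (z 0) ≡ ι n u
      -- The path passes through `z n`, one stage above `u`, so the same formula serves stage 0.
      contract-stage n u = trans (centre-z n) (sym (to-z n u))

      -- Naturality of the homotopy `H` at `k`: both sides equal `W` followed by the inverse of
      -- `cong i k`. This gives the coherence of `contract-stage` along `push`.
      naturality-square : ∀ {F T : Set} (i : F → T) {v w : F} {s t c : T}
        (π : s ≡ i v) (k : v ≡ w) (H : ∀ v → i v ≡ t) (W : c ≡ i w) →
        trans (trans W (sym (trans π (cong i k)))) π ≡ trans (trans W (H w)) (sym (H v))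
      naturality-square i {v} refl refl H W = begin
        trans (trans W refl) refl          ≡⟨ trans-reflʳ _ ⟩
        trans W refl                       ≡⟨ cong (trans W) (trans-symʳ (H v)) ⟨
        trans W (trans (H v) (sym (H v)))  ≡⟨ trans-assoc W ⟨
        trans (trans W (H v)) (sym (H v))  ∎
        where open ≡-Reasoning

      -- Transport in this family composes each path with a lift of `p` to the total space, so the
      -- condition of the eliminator becomes one triangle for each `e`.
      subst-contract : ∀ {x y} {c : Σ Q.Carrier E} (p : x ≡ y)
        (φ : ∀ e → c ≡ (x , e)) (ψ : ∀ e → c ≡ (y , e)) →
        (∀ e → trans (φ e) (Σ-≡,≡→≡ (p , refl)) ≡ ψ (subst E p e)) →
        subst (λ x → ∀ e → c ≡ (x , e)) p φ ≡ ψ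
      subst-contract refl φ ψ h = funext λ e → trans (sym (trans-reflʳ (φ e))) (h e)

      contract : ∀ x e → ι 1 (z 0) ≡ (x , e)
      contract = ind _ (λ n x e → contract-stage n (x , e)) λ n x →
        subst-contract (push n x) _ _ λ e →
          naturality-square (ι (suc n)) (π n (x , e)) (σ≡z n (x , e)) (to-z (suc n)) (centre-z n)

  module _ {A B C : Set} (f : A → C) (g : B → C) where
    private module J = PushoutOf (pushout {C = Pullback H f g} proj₁ (proj₁ ∘ proj₂))

    -- A general `h` is allowed because the map out of the colimit restricts to `join-map` only up
    -- to identification; function extensionality reduces to `join-map` itself.
    join-inl-fibre-constant : ∀ {b c} → g b ≡ c → (h : Join H f g → C) → (∀ x → join-map H f g x ≡ h x) →
      Σ[ z ∈ Fibre h c ] (∀ a (p : h (J.inl a) ≡ c) → (J.inl a , p) ≡ z)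
    join-inl-fibre-constant {b} {c} q h h≡ = subst
      (λ h → Σ[ z ∈ Fibre h c ] (∀ a (p : h (J.inl a) ≡ c) → (J.inl a , p) ≡ z))
      (funext h≡)
      -- Both `f a` and `g b` are identified with `c`, by way of `p` and `q`; this supplies the glue
      -- from `inl a` to `inr b`.
      ((J.inr b , trans (inr-β b) q) , λ a p → Σ-≡,≡→≡ (J.glue (a , b , over a p) ,
        subst-fibre (join-map H f g) (J.glue _) (inl-β a) (inr-β b) (over a p) q
          (J.ind-glue _ f g _ (a , b , over a p)) p (split (inl-β a) p q)))
      where
      inl-β : ∀ a → join-map H f g (J.inl a) ≡ f a
      inl-β = J.ind-inl _ f g _
      inr-β : ∀ b → join-map H f g (J.inr b) ≡ g b
      inr-β = J.ind-inr _ f g _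
      over : ∀ a → join-map H f g (J.inl a) ≡ c → f a ≡ g b
      over a p = trans (sym (inl-β a)) (trans p (sym q))
      split : ∀ {x y z w : C} (d : x ≡ y) (p : x ≡ z) (q : w ≡ z) →
              p ≡ trans d (trans (trans (sym d) (trans p (sym q))) q)
      split refl refl refl = refl

  module _ {A C : Set} (g : ℕ → A → C) where
    private module Q = SeqColimOf (seqColim (L H g) (L-incl H g))

    L-map : ∀ n → L H g n → C
    L-map n = proj₂ (iterated-join H g n)

    private
      L-map-incl : ∀ n x → subst (λ _ → C) (Q.push n x) (L-map n x) ≡ L-map (suc n) (L-incl H g n x)
      L-map-incl n x = trans (subst-const (Q.push n x))
        (sym (PushoutOf.ind-inl (pushout _ _) _ (L-map n) (g n) _ x))

    L∞-map : L∞ H g → C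
    L∞-map = Q.ind (λ _ → C) L-map L-map-incl

    L∞-map-fibre-isContr : ∀ {c} → (∀ n → Fibre (g n) c) → isContr (Fibre L∞-map c)
    -- For this family, the total space of stage `n` is the fibre of `L∞-map ∘ Q.incl n` over `c`.
    L∞-map-fibre-isContr {c} b = Σ-seqColim-isContr (λ x → L∞-map x ≡ c)
      (proj₁ ∘ constant) (λ n (x , e) → proj₂ (constant n) x _)
      where
      constant : ∀ n → Σ[ z ∈ Fibre (L∞-map ∘ Q.incl (suc n)) c ]
                       (∀ x p → (L-incl H g n x , p) ≡ z)
      constant n = join-inl-fibre-constant (L-map n) (g n) (proj₂ (b n)) (L∞-map ∘ Q.incl (suc n))
        (λ x → sym (Q.ind-incl _ L-map L-map-incl (suc n) x))

    L∞≃ : isConnected H C → ∀ {c} → (∀ n → Fibre (g n) c) → L∞ H g ≃ C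
    L∞≃ conn b = contractible-fibres⇒≃ L∞-map
      (connected-ind conn _ (λ _ → Irrelevant-isContr) (L∞-map-fibre-isContr b))

theorem6p2 : (H : HoTT) (m : ℕ) .{{_ : NonZero m}}
    (l : ℕ → ℤ) → (∀ i → Coprime (l i) (+ m)) →
    (Bℤ/m : Set) (d : IsDelooping H (ℤ/m-group m) Bℤ/m)
    (Bφ : ∀ i → DeloopingMap H (S¹-delooping H) d (φ m (l i))) →
    let L^∞ = L∞ H (λ i → DeloopingMap.fun (Bφ i)) in
    IsDelooping H (ℤ/m-group m) L^∞ × (L^∞ ≃ Bℤ/m)
theorem6p2 H m l _ Bℤ/m d Bφ = subst (IsDelooping H (ℤ/m-group m)) (sym (ua H e)) d , e
  where
  e : L∞ H (λ i → DeloopingMap.fun (Bφ i)) ≃ Bℤ/m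
  e = L∞≃ H (λ i → DeloopingMap.fun (Bφ i)) (IsDelooping.connected d)
        -- The base point of the circle lies over the base point of `Bℤ/m` under each map.
        (λ i → _ , DeloopingMap.pointed (Bφ i))
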